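{- Let $\varphi$ be a quantifier-free formula in the SMT theory of floating-point numbers and $\mathit{cost}$ a floating-point variable occurring in $\varphi$ with $n$ bits, and suppose $\varphi_{\mathrm{noNaN}}:=\varphi\wedge\neg\mathrm{isNaN}(\mathit{cost})$ is satisfiable; consider minimization (resp. maximization) of $\mathit{cost}$. Let $T$ be the attractor trajectory defined below. Then any model $\mathcal{M}$ of $\varphi_{\mathrm{noNaN}}$ which lexicographically maximizes $T$ with respect to $\varphi_{\mathrm{noNaN}}$ is an optimal solution of the problem, i.e. there is no model $\mathcal{M}'$ of $\varphi_{\mathrm{noNaN}}$ with $\mathcal{M}'(\mathit{cost})<\mathcal{M}(\mathit{cost})$ (resp. $\mathcal{M}'(\mathit{cost})>\mathcal{M}(\mathit{cost})$).
   Context: Bits of $\mathit{cost}$ are indexed from most significant $\mathit{cost}[0]$ (sign) to least significant $\mathit{cost}[n-1]$; $n=e+s$ where $e$ is the number of exponent bits and $s$ the number of significand bits including the hidden bit, with IEEE 754-2008 binary semantics: with bias $b=2^{e-1}-1$, exponent field $E$ all ones and significand $m=0$ gives $\pm\infty$, $E$ all ones and $m\neq0$ gives NaN, $E=0$ gives the subnormal $(-1)^\sigma2^{1-b}(0.m)_2$, otherwise the normal $(-1)^\sigma2^{E-b}(1.m)_2$. The order $\le,<$ is the usual total order on non-NaN floating-point values ($+0$ and $-0$ equal). For an assignment $\tau_k$ to the $k$ most significant bits of $\mathit{cost}$, the dynamic attractor $d_{\tau_k}$ is the smallest (resp. largest) non-NaN floating-point value whose $k$ most significant bits agree with $\tau_k$,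 and $A^{\tau_k}[i]:=(\mathit{cost}[i]=d_{\tau_k}[i])$. Inductively, $\tau_0=\emptyset$ and for $k\in[0..n-1]$, $\tau_{k+1}=\tau_k\cup\{\mathit{cost}[k]:=b_k\}$ where $b_k=\overline{d_{\tau_k}[k]}$ if $\varphi_{\mathrm{noNaN}}\wedge\tau_k\wedge A^{\tau_k}[k]$ is unsatisfiable and $b_k=d_{\tau_k}[k]$ otherwise. The attractor trajectory is $T=[A^{\tau_0}[0],\dots,A^{\tau_{n-1}}[n-1]]$. For an assignment $\mu$ to all bits of $\mathit{cost}$, $\mu|_k$ is its restriction to $\mathit{cost}[0..k-1]$; $\mu$ lexicographically maximizes $T$ with respect to $\varphi_{\mathrm{noNaN}}$ iff for every $k\in[0..n-1]$: $\mu[k]=\overline{d_{\tau_k}[k]}$ if $\varphi_{\mathrm{noNaN}}\wedge\mu|_k\wedge T[k]$ is unsatisfiable, and $\mu[k]=d_{\tau_k}[k]$ otherwise. A model lexicographically maximizes $T$ iff its restriction to the bits of $\mathit{cost}$ does. -}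

module Defs where

open import Data.Bool.Base using (Bool; true; false; not; _∧_; _∨_; _xor_; if_then_else_; T)
open import Data.Empty using (⊥)
open import Data.Fin.Base using (Fin; toℕ)
open import Data.Integer.Base as ℤ using (ℤ; +_; -[1+_]; 0ℤ; 1ℤ; ∣_∣)
open import Data.Integer.DivMod using (_%ℕ_)
open import Data.List.Base using (List; []; _∷_)
open import Data.List.Relation.Unary.All using (All; []; _∷_)
open import Data.Nat.Base using (ℕ; zero; suc; _+_; _∸_; _*_; _^_; _<_; _≡ᵇ_; _/_; _%_; NonZero)
open import Data.Nat.Properties using (m^n≢0; +-suc)
open import Data.Product.Base using (Σ; ∃; ∃-syntax; _×_; _,_)
open import Data.Rational.Base as ℚ using (ℚ; 0ℚ; 1ℚ; ½; floor; ceiling; truncate)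
open import Data.Rational.Properties as ℚ using (_<?_; <-trans; <-dense; <-asym; <-cmp)
open import Data.Sum.Base using (_⊎_; inj₁; inj₂)
open import Data.Unit.Base using (⊤)
open import Data.Vec.Base as Vec using (Vec; []; _∷_; _++_; head; tail; take; drop; replicate; lookup)
open import Function.Bundles using (_⇔_; mk⇔)
open import Relation.Binary.Definitions using (Tri; tri<; tri≈; tri>)
open import Relation.Binary.PropositionalEquality using (_≡_; _≢_; refl; sym)
open import Relation.Nullary.Decidable using (yes; no; isYes; toWitness; fromWitness)
open import Relation.Nullary.Negation using (¬_; contradiction)

bin : ∀ {w} → Vec Bool w → ℕ
bin {zero}  []       = 0
bin {suc w} (b ∷ bs) = (if b then 2 ^ w else 0) + bin bs

-- The numeral of k modulo 2 ^ w.
toBits : ∀ w → ℕ → Vec Bool w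
toBits zero    k = []
toBits (suc w) k = (_/_ k (2 ^ w) {{m^n≢0 2 w}} % 2 ≡ᵇ 1) ∷ toBits w k

pow2 : ℤ → ℚ
pow2 (+ k)    = + (2 ^ k) ℚ./ 1
pow2 -[1+ k ] = ℚ._/_ 1ℤ (2 ^ suc k) {{m^n≢0 2 (suc k)}}

fromℤ : ℤ → ℚ
fromℤ z = z ℚ./ 1

-- SMT-LIB admits exactly the formats with more than one exponent bit and
-- more than one significand bit (hidden bit included); the two fields are
-- the excesses over these minima.
record Format : Set where
  constructor format
  field
    e⁻ m⁻ : ℕ

  e : ℕ            -- exponent bits
  e = 2 + e⁻

  m : ℕ            -- stored significand bits
  m = 1 + m⁻

  s : ℕ            -- significand bits including the hidden one
  s = 1 + m

  n : ℕ
  n = 1 + (e + m)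

  n≡e+s : n ≡ e + s
  n≡e+s = sym (+-suc e m)

  bias : ℕ
  bias = 2 ^ (e ∸ 1) ∸ 1

  -- The value of E = maxE, M = 0 under the formula for normal numbers is
  -- the first power of two beyond the largest finite number.
  maxE : ℕ
  maxE = 2 ^ e ∸ 1

open Format public using (bias; maxE)

-- All bit patterns, so NaN has several representations; they are identified
-- by the equality predicate of the theory (_≈ᶠ_ below).
Float : Format → Set
Float f = Vec Bool (Format.n f)

signBit : ∀ f → Float f → Bool
signBit f x = head x

exponent : ∀ f → Float f → ℕ
exponent f x = bin (take (Format.e f) (tail x))

significand : ∀ f → Float f → ℕ
significand f x = bin (drop (Format.e f) (tail x))

-- (0.m)₂
fraction : Format → ℕ → ℚ
fraction f M = ℚ._/_ (+ M) (2 ^ Format.m f) {{m^n≢0 2 (Format.m f)}}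

magnitude : Format → ℕ → ℕ → ℚ
magnitude f zero      M = pow2 (1ℤ ℤ.- + bias f) ℚ.* fraction f M
magnitude f E@(suc _) M = pow2 (+ E ℤ.- + bias f) ℚ.* (1ℚ ℚ.+ fraction f M)

data Value : Set where
  NaN : Value
  -∞  : Value
  fin : ℚ → Value
  +∞  : Value

value : ∀ f → Float f → Value
value f x =
  if exponent f x ≡ᵇ maxE f
  then (if significand f x ≡ᵇ 0 then (if signBit f x then -∞ else +∞) else NaN)
  else fin (if signBit f x then ℚ.- r else r)
  where
  r : ℚ
  r = magnitude f (exponent f x) (significand f x)

infix 4 _<ᵛ_ _≤ᵛ_

data _<ᵛ_ : Value → Value → Set where
  -∞<fin  : ∀ {q} → -∞ <ᵛ fin q
  -∞<+∞   : -∞ <ᵛ +∞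
  fin<fin : ∀ {p q} → p ℚ.< q → fin p <ᵛ fin q
  fin<+∞  : ∀ {p} → fin p <ᵛ +∞

data _≤ᵛ_ : Value → Value → Set where
  -∞≤     : ∀ {v} → v ≢ NaN → -∞ ≤ᵛ v
  fin≤fin : ∀ {p q} → p ℚ.≤ q → fin p ≤ᵛ fin q
  ≤+∞     : ∀ {v} → v ≢ NaN → v ≤ᵛ +∞

-- lower q means q < r, upper q means r < q.
record Cut : Set where
  field
    lower upper : ℚ → Bool

-- Dedekind cuts with decided membership. Classically every real number is
-- of this form.
record Real : Set where
  field
    cut : Cut
  open Cut cut public
  field
    lower-inhabited : ∃[ q ] T (lower q)
    upper-inhabited : ∃[ q ] T (upper q)
    lower-rounded   : ∀ p → T (lower p) ⇔ (∃[ q ] (p ℚ.< q × T (lower q)))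
    upper-rounded   : ∀ q → T (upper q) ⇔ (∃[ p ] (p ℚ.< q × T (upper p)))
    disjoint        : ∀ q → T (lower q) → T (upper q) → ⊥
    located         : ∀ {p q} → p ℚ.< q → T (lower p) ⊎ T (upper q)

cutℚ : ℚ → Cut
cutℚ r = record { lower = λ q → isYes (q <? r) ; upper = λ q → isYes (r <? q) }

private
  p-1<p : ∀ p → p ℚ.- 1ℚ ℚ.< p
  p-1<p p = ℚ.<-respʳ-≡ (ℚ.+-identityʳ p)
    (ℚ.+-monoʳ-< p (toWitness {a? = (ℚ.- 1ℚ) <? 0ℚ} _))

  p<p+1 : ∀ p → p ℚ.< p ℚ.+ 1ℚ
  p<p+1 p = ℚ.<-respˡ-≡ (ℚ.+-identityʳ p)
    (ℚ.+-monoʳ-< p (toWitness {a? = 0ℚ <? 1ℚ} _))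

realℚ : ℚ → Real
realℚ r = record
  { cut             = cutℚ r
  ; lower-inhabited = r ℚ.- 1ℚ , fromWitness (p-1<p r)
  ; upper-inhabited = r ℚ.+ 1ℚ , fromWitness (p<p+1 r)
  ; lower-rounded   = λ p → mk⇔
      (λ l → let q , p<q , q<r = <-dense (toWitness l) in q , p<q , fromWitness q<r)
      (λ (q , p<q , l) → fromWitness (<-trans p<q (toWitness l)))
  ; upper-rounded   = λ q → mk⇔
      (λ u → let p , r<p , p<q = <-dense (toWitness u) in p , p<q , fromWitness r<p)
      (λ (p , p<q , u) → fromWitness (<-trans (toWitness u) p<q))
  ; disjoint        = λ q l u → <-asym (toWitness l) (toWitness u)
  ; located         = λ {p} {q} p<q → loc p q p<q (<-cmp p r)
  }
  where
  loc : ∀ p q → p ℚ.< q → Tri (p ℚ.< r) (p ≡ r) (r ℚ.< p) → T (isYes (p <? r)) ⊎ T (isYes (r <? q))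
  loc p q p<q (tri< p<r _ _)  = inj₁ (fromWitness p<r)
  loc p q p<q (tri≈ _ refl _) = inj₂ (fromWitness p<q)
  loc p q p<q (tri> _ _ r<p)  = inj₂ (fromWitness (<-trans r<p p<q))

_≈ʳ_ : Real → Real → Set
r ≈ʳ r′ = ∀ q → Real.lower r q ≡ Real.lower r′ q × Real.upper r q ≡ Real.upper r′ q

negCut : Cut → Cut
negCut c = record { lower = λ q → Cut.upper c (ℚ.- q) ; upper = λ q → Cut.lower c (ℚ.- q) }

-- For r ≥ 0.
sqrtCut : ℚ → Cut
sqrtCut r = record
  { lower = λ q → isYes (q <? 0ℚ) ∨ isYes (q ℚ.* q <? r)
  ; upper = λ q → isYes (0ℚ <? q) ∧ isYes (r <? q ℚ.* q)
  }

data RoundingMode : Set where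
  RNE RNA RTP RTN RTZ : RoundingMode

isRTN : RoundingMode → Bool
isRTN RTN = true
isRTN _   = false

odd : ℕ → Bool
odd k = k % 2 ≡ᵇ 1

-- The largest j < k satisfying P (0 if there is none).
greatestBelow : ℕ → (ℕ → Bool) → ℕ
greatestBelow zero    P = 0
greatestBelow (suc k) P = if P k then k else greatestBelow k P

-- The exponent and significand fields, read together as the integer
-- k = E · 2 ^ m + M, enumerate the magnitudes of a format in increasing
-- order; k = maxE · 2 ^ m is the bit pattern of infinity.
∞-index : Format → ℕ
∞-index f = maxE f * 2 ^ Format.m f

indexed : Format → ℕ → ℚ
indexed f k = magnitude f (_/_ k (2 ^ m) {{m^n≢0 2 m}}) (_%_ k (2 ^ m) {{m^n≢0 2 m}})
  where
  m : ℕ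
  m = Format.m f

-- c is the absolute value and σ the sign of the number to be rounded.
-- The parity of the index is that of the significand, and a step up from
-- the largest finite magnitude yields infinity.
roundIndex : ∀ f → RoundingMode → (σ : Bool) → Cut → ℕ
roundIndex f rm σ c = if Cut.lower c (indexed f k) ∧ up rm then suc k else k
  where
  k : ℕ
  k = greatestBelow (∞-index f) (λ j → not (Cut.upper c (indexed f j)))

  mid : ℚ
  mid = ½ ℚ.* (indexed f k ℚ.+ indexed f (suc k))

  up : RoundingMode → Bool
  up RNE = Cut.lower c mid ∨ (not (Cut.upper c mid) ∧ odd k)
  up RNA = not (Cut.upper c mid)
  up RTP = not σ
  up RTN = σ
  up RTZ = false

zeroᶠ ∞ᶠ : ∀ f → Bool → Float f
zeroᶠ f σ = σ ∷ replicate _ false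
∞ᶠ    f σ = σ ∷ (replicate (Format.e f) true ++ replicate (Format.m f) false)

nanᶠ : ∀ f → Float f
nanᶠ f = replicate _ true

-- σ₀ is the sign of the result when the exact value is zero.
round : ∀ f → RoundingMode → (σ₀ : Bool) → Cut → Float f
round f rm σ₀ c =
  if Cut.upper c 0ℚ then true ∷ toBits _ (roundIndex f rm true (negCut c))
  else if Cut.lower c 0ℚ then false ∷ toBits _ (roundIndex f rm false c)
  else zeroᶠ f σ₀

roundℚ : ∀ f → RoundingMode → (σ₀ : Bool) → ℚ → Float f
roundℚ f rm σ₀ q = round f rm σ₀ (cutℚ q)

roundℤ : RoundingMode → ℚ → ℤ
roundℤ RNE q =
  if isYes (q <? mid) then floor q
  else if isYes (mid <? q) then 1ℤ ℤ.+ floor q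
  else if odd ∣ floor q ∣ then 1ℤ ℤ.+ floor q
  else floor q
  where
  mid : ℚ
  mid = fromℤ (floor q) ℚ.+ ½
roundℤ RNA q = ℚ.round q
roundℤ RTP q = ceiling q
roundℤ RTN q = floor q
roundℤ RTZ q = truncate q

isZeroᵇ : ∀ f → Float f → Bool
isZeroᵇ f x = (exponent f x ≡ᵇ 0) ∧ (significand f x ≡ᵇ 0)

-- The sign of an exact zero sum of summands with signs σ and τ.
sumSign : RoundingMode → Bool → Bool → Bool
sumSign rm σ τ = if σ xor τ then isRTN rm else σ

absᶠ negᶠ : ∀ f → Float f → Float f
absᶠ f (_ ∷ x) = false ∷ x
negᶠ f (σ ∷ x) = not σ ∷ x

addᶠ subᶠ mulᶠ divᶠ : ∀ f → RoundingMode → Float f → Float f → Float f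

addᶠ f rm x y with value f x | value f y
... | NaN   | _     = nanᶠ f
... | _     | NaN   = nanᶠ f
... | fin p | fin q = roundℚ f rm (sumSign rm (signBit f x) (signBit f y)) (p ℚ.+ q)
... | fin _ | _     = y
... | _     | fin _ = x
... | _     | _     = if signBit f x xor signBit f y then nanᶠ f else x

subᶠ f rm x y = addᶠ f rm x (negᶠ f y)

mulᶠ f rm x y with value f x | value f y
... | NaN   | _     = nanᶠ f
... | _     | NaN   = nanᶠ f
... | fin p | fin q = roundℚ f rm (signBit f x xor signBit f y) (p ℚ.* q)
... | _     | _     = if isZeroᵇ f x ∨ isZeroᵇ f y then nanᶠ f
                      else ∞ᶠ f (signBit f x xor signBit f y)

divᶠ f rm x y with value f x | value f y
... | NaN   | _     = nanᶠ f
... | _     | NaN   = nanᶠ f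
... | fin p | fin q with q ℚ.≟ 0ℚ
...   | no q≢0 = roundℚ f rm (signBit f x xor signBit f y) (ℚ._÷_ p q {{ℚ.≢-nonZero q≢0}})
...   | yes _  = if isZeroᵇ f x then nanᶠ f else ∞ᶠ f (signBit f x xor signBit f y)
divᶠ f rm x y | fin _ | _     = zeroᶠ f (signBit f x xor signBit f y)
divᶠ f rm x y | _     | fin _ = ∞ᶠ f (signBit f x xor signBit f y)
divᶠ f rm x y | _     | _     = nanᶠ f

fmaᶠ : ∀ f → RoundingMode → Float f → Float f → Float f → Float f
fmaᶠ f rm x y z = go (value f x) (value f y) (value f z)
  where
  σ : Bool
  σ = signBit f x xor signBit f y

  infiniteProduct : Value → Float f
  infiniteProduct (fin _) = ∞ᶠ f σ
  infiniteProduct _       = if σ xor signBit f z then nanᶠ f else ∞ᶠ f σ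

  go : Value → Value → Value → Float f
  go NaN     _       _       = nanᶠ f
  go _       NaN     _       = nanᶠ f
  go _       _       NaN     = nanᶠ f
  go (fin p) (fin q) (fin r) = roundℚ f rm (sumSign rm σ (signBit f z)) (p ℚ.* q ℚ.+ r)
  go (fin _) (fin _) _       = z
  go _       _       v       = if isZeroᵇ f x ∨ isZeroᵇ f y then nanᶠ f else infiniteProduct v

sqrtᶠ : ∀ f → RoundingMode → Float f → Float f
sqrtᶠ f rm x with value f x
... | NaN   = nanᶠ f
... | -∞    = nanᶠ f
... | +∞    = x
... | fin q = if isZeroᵇ f x then x
              else if signBit f x then nanᶠ f
              else round f rm false (sqrtCut q)

-- x - y · n for the integer n nearest to x / y (ties to even); this is
-- always representable, so the rounding mode is immaterial.
remᶠ : ∀ f → Float f → Float f → Float f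
remᶠ f x y with value f x | value f y
... | NaN   | _     = nanᶠ f
... | _     | NaN   = nanᶠ f
... | fin p | fin q with q ℚ.≟ 0ℚ
...   | no q≢0 = roundℚ f RNE (signBit f x)
                   (p ℚ.- q ℚ.* fromℤ (roundℤ RNE (ℚ._÷_ p q {{ℚ.≢-nonZero q≢0}})))
...   | yes _  = nanᶠ f
remᶠ f x y | fin _ | _ = x
remᶠ f x y | _     | _ = nanᶠ f

roundToIntegralᶠ : ∀ f → RoundingMode → Float f → Float f
roundToIntegralᶠ f rm x with value f x
... | fin q = roundℚ f rm (signBit f x) (fromℤ (roundℤ rm q))
... | _     = x

convertᶠ : ∀ f g → RoundingMode → Float f → Float g
convertᶠ f g rm x with value f x
... | NaN   = nanᶠ g
... | -∞    = ∞ᶠ g true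
... | +∞    = ∞ᶠ g false
... | fin q = roundℚ g rm (signBit f x) q

signed : ∀ {w} → Vec Bool (suc w) → ℤ
signed {w} (b ∷ bs) = + bin bs ℤ.- (if b then + (2 ^ w) else 0ℤ)

-- The results that SMT-LIB leaves unspecified; every model fixes them.
record Unspecified : Set where
  field
    -- Sign of the result for two zeros of opposite sign, given the sign of
    -- the first one.
    minZero maxZero : Format → Bool → Bool
    -- Conversion of NaN, of infinities and of numbers out of range.
    toUbv toSbv     : Format → (w : ℕ) → RoundingMode → Value → Vec Bool (suc w)
    toReal          : Format → Value → Real

minᶠ maxᶠ : Unspecified → ∀ f → Float f → Float f → Float f
minᶠ U f x y with value f x | value f y
... | NaN   | _     = y
... | _     | NaN   = x
... | -∞    | _     = x
... | _     | -∞    = y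
... | +∞    | _     = y
... | _     | +∞    = x
... | fin p | fin q with <-cmp p q
...   | tri< _ _ _ = x
...   | tri> _ _ _ = y
...   | tri≈ _ _ _ = if signBit f x xor signBit f y then zeroᶠ f (Unspecified.minZero U f (signBit f x)) else x
maxᶠ U f x y with value f x | value f y
... | NaN   | _     = y
... | _     | NaN   = x
... | +∞    | _     = x
... | _     | +∞    = y
... | -∞    | _     = y
... | _     | -∞    = x
... | fin p | fin q with <-cmp p q
...   | tri< _ _ _ = y
...   | tri> _ _ _ = x
...   | tri≈ _ _ _ = if signBit f x xor signBit f y then zeroᶠ f (Unspecified.maxZero U f (signBit f x)) else x

toUbvᶠ toSbvᶠ : Unspecified → ∀ f w → RoundingMode → Float f → Vec Bool (suc w)
toUbvᶠ U f w rm x with value f x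
... | fin q = if (0ℤ ℤ.≤ᵇ z) ∧ (z ℤ.+ 1ℤ ℤ.≤ᵇ + (2 ^ suc w))
              then toBits (suc w) ∣ z ∣
              else Unspecified.toUbv U f w rm (fin q)
  where
  z : ℤ
  z = roundℤ rm q
... | v     = Unspecified.toUbv U f w rm v
toSbvᶠ U f w rm x with value f x
... | fin q = if (ℤ.- (+ (2 ^ w)) ℤ.≤ᵇ z) ∧ (z ℤ.+ 1ℤ ℤ.≤ᵇ + (2 ^ w))
              then toBits (suc w) (_%ℕ_ z (2 ^ suc w) {{m^n≢0 2 (suc w)}})
              else Unspecified.toSbv U f w rm (fin q)
  where
  z : ℤ
  z = roundℤ rm q
... | v     = Unspecified.toSbv U f w rm v

toRealᶠ : Unspecified → ∀ f → Float f → Real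
toRealᶠ U f x with value f x
... | fin q = realℚ q
... | v     = Unspecified.toReal U f v

isNaN NonNaN isNormal isSubnormal isZero isInfinite isNegative isPositive : ∀ f → Float f → Set
isNaN       f x = value f x ≡ NaN
NonNaN      f x = ¬ isNaN f x
isNormal    f x = exponent f x ≢ 0 × exponent f x ≢ maxE f
isSubnormal f x = exponent f x ≡ 0 × significand f x ≢ 0
isZero      f x = exponent f x ≡ 0 × significand f x ≡ 0
isInfinite  f x = value f x ≡ -∞ ⊎ value f x ≡ +∞
isNegative  f x = NonNaN f x × signBit f x ≡ true
isPositive  f x = NonNaN f x × signBit f x ≡ false

_≈ᶠ_ : ∀ {f} → Float f → Float f → Set
_≈ᶠ_ {f} x y = (isNaN f x × isNaN f y) ⊎ x ≡ y

infix 4 _≤ᶠ_ _<ᶠ_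

_≤ᶠ_ _<ᶠ_ : ∀ {f} → Float f → Float f → Set
_≤ᶠ_ {f} x y = value f x ≤ᵛ value f y
_<ᶠ_ {f} x y = value f x <ᵛ value f y

data Sort : Set where
  roundingMode real : Sort
  bitVec            : (w : ℕ) → Sort        -- width suc w
  float             : Format → Sort

⟦_⟧ˢ : Sort → Set
⟦ roundingMode ⟧ˢ = RoundingMode
⟦ real ⟧ˢ         = Real
⟦ bitVec w ⟧ˢ     = Vec Bool (suc w)
⟦ float f ⟧ˢ      = Float f

data Op : List Sort → Sort → Set where
  rmLit           : RoundingMode → Op [] roundingMode
  realLit         : ℚ → Op [] real
  bvLit           : ∀ {w} → Vec Bool (suc w) → Op [] (bitVec w)
  floatLit        : ∀ {f} → Float f → Op [] (float f)
  fp              : ∀ {f} → Op (bitVec 0 ∷ bitVec (1 + Format.e⁻ f) ∷ bitVec (Format.m⁻ f) ∷ []) (float f)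
  abs neg         : ∀ {f} → Op (float f ∷ []) (float f)
  add sub mul div : ∀ {f} → Op (roundingMode ∷ float f ∷ float f ∷ []) (float f)
  fma             : ∀ {f} → Op (roundingMode ∷ float f ∷ float f ∷ float f ∷ []) (float f)
  sqrt            : ∀ {f} → Op (roundingMode ∷ float f ∷ []) (float f)
  rem             : ∀ {f} → Op (float f ∷ float f ∷ []) (float f)
  roundToIntegral : ∀ {f} → Op (roundingMode ∷ float f ∷ []) (float f)
  min max         : ∀ {f} → Op (float f ∷ float f ∷ []) (float f)
  fromBits        : ∀ {f} → Op (bitVec (Format.e f + Format.m f) ∷ []) (float f)
  fromFloat       : ∀ {f g} → Op (roundingMode ∷ float f ∷ []) (float g)
  fromReal        : ∀ {f} → Op (roundingMode ∷ real ∷ []) (float f)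
  fromSigned      : ∀ {f w} → Op (roundingMode ∷ bitVec w ∷ []) (float f)
  fromUnsigned    : ∀ {f w} → Op (roundingMode ∷ bitVec w ∷ []) (float f)
  toUnsigned      : ∀ {f w} → Op (roundingMode ∷ float f ∷ []) (bitVec w)
  toSigned        : ∀ {f w} → Op (roundingMode ∷ float f ∷ []) (bitVec w)
  toReal          : ∀ {f} → Op (float f ∷ []) real

data Pred : List Sort → Set where
  equal              : ∀ {σ} → Pred (σ ∷ σ ∷ [])
  leq lt geq gt eq   : ∀ {f} → Pred (float f ∷ float f ∷ [])
  normal subnormal zero infinite nan negative positive : ∀ {f} → Pred (float f ∷ [])

⟦_⟧ᵒ : ∀ {σs σ} → Op σs σ → Unspecified → All ⟦_⟧ˢ σs → ⟦ σ ⟧ˢ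
⟦ rmLit rm ⟧ᵒ           U []                    = rm
⟦ realLit q ⟧ᵒ          U []                    = realℚ q
⟦ bvLit v ⟧ᵒ            U []                    = v
⟦ floatLit x ⟧ᵒ         U []                    = x
⟦ fp ⟧ᵒ                 U (σ ∷ E ∷ M ∷ [])      = σ ++ (E ++ M)
⟦ abs {f} ⟧ᵒ            U (x ∷ [])              = absᶠ f x
⟦ neg {f} ⟧ᵒ            U (x ∷ [])              = negᶠ f x
⟦ add {f} ⟧ᵒ            U (rm ∷ x ∷ y ∷ [])     = addᶠ f rm x y
⟦ sub {f} ⟧ᵒ            U (rm ∷ x ∷ y ∷ [])     = subᶠ f rm x y
⟦ mul {f} ⟧ᵒ            U (rm ∷ x ∷ y ∷ [])     = mulᶠ f rm x y
⟦ div {f} ⟧ᵒ            U (rm ∷ x ∷ y ∷ [])     = divᶠ f rm x y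
⟦ fma {f} ⟧ᵒ            U (rm ∷ x ∷ y ∷ z ∷ []) = fmaᶠ f rm x y z
⟦ sqrt {f} ⟧ᵒ           U (rm ∷ x ∷ [])         = sqrtᶠ f rm x
⟦ rem {f} ⟧ᵒ            U (x ∷ y ∷ [])          = remᶠ f x y
⟦ roundToIntegral {f} ⟧ᵒ U (rm ∷ x ∷ [])        = roundToIntegralᶠ f rm x
⟦ min {f} ⟧ᵒ            U (x ∷ y ∷ [])          = minᶠ U f x y
⟦ max {f} ⟧ᵒ            U (x ∷ y ∷ [])          = maxᶠ U f x y
⟦ fromBits ⟧ᵒ           U (v ∷ [])              = v
⟦ fromFloat {f} {g} ⟧ᵒ  U (rm ∷ x ∷ [])         = convertᶠ f g rm x
⟦ fromReal {f} ⟧ᵒ       U (rm ∷ r ∷ [])         = round f rm false (Real.cut r)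
⟦ fromSigned {f} ⟧ᵒ     U (rm ∷ v ∷ [])         = roundℚ f rm false (fromℤ (signed v))
⟦ fromUnsigned {f} ⟧ᵒ   U (rm ∷ v ∷ [])         = roundℚ f rm false (fromℤ (+ bin v))
⟦ toUnsigned {f} {w} ⟧ᵒ U (rm ∷ x ∷ [])         = toUbvᶠ U f w rm x
⟦ toSigned {f} {w} ⟧ᵒ   U (rm ∷ x ∷ [])         = toSbvᶠ U f w rm x
⟦ toReal {f} ⟧ᵒ         U (x ∷ [])              = toRealᶠ U f x

equalAt : ∀ σ → ⟦ σ ⟧ˢ → ⟦ σ ⟧ˢ → Set
equalAt roundingMode x y = x ≡ y
equalAt real         x y = x ≈ʳ y
equalAt (bitVec _)   x y = x ≡ y
equalAt (float f)    x y = _≈ᶠ_ {f} x y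

⟦_⟧ᵖ : ∀ {σs} → Pred σs → All ⟦_⟧ˢ σs → Set
⟦ equal {σ} ⟧ᵖ     (x ∷ y ∷ []) = equalAt σ x y
⟦ leq {f} ⟧ᵖ       (x ∷ y ∷ []) = _≤ᶠ_ {f} x y
⟦ lt {f} ⟧ᵖ        (x ∷ y ∷ []) = _<ᶠ_ {f} x y
⟦ geq {f} ⟧ᵖ       (x ∷ y ∷ []) = _≤ᶠ_ {f} y x
⟦ gt {f} ⟧ᵖ        (x ∷ y ∷ []) = _<ᶠ_ {f} y x
⟦ eq {f} ⟧ᵖ        (x ∷ y ∷ []) = NonNaN f x × value f x ≡ value f y
⟦ normal {f} ⟧ᵖ    (x ∷ [])     = isNormal f x
⟦ subnormal {f} ⟧ᵖ (x ∷ [])     = isSubnormal f x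
⟦ zero {f} ⟧ᵖ      (x ∷ [])     = isZero f x
⟦ infinite {f} ⟧ᵖ  (x ∷ [])     = isInfinite f x
⟦ nan {f} ⟧ᵖ       (x ∷ [])     = isNaN f x
⟦ negative {f} ⟧ᵖ  (x ∷ [])     = isNegative f x
⟦ positive {f} ⟧ᵖ  (x ∷ [])     = isPositive f x

data Term : Sort → Set where
  var : ∀ σ → ℕ → Term σ
  app : ∀ {σs σ} → Op σs σ → All Term σs → Term σ

infixr 6 _`∧_
infixr 5 _`∨_
infixr 4 _`⇒_
infix  7 `¬_

-- Term-level if-then-else adds no expressive power: an atom P (ite φ t u)
-- is equivalent to (φ ∧ P t) ∨ (¬ φ ∧ P u).
data Formula : Set where
  `⊤ `⊥         : Formula
  boolVar       : ℕ → Formula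
  atom          : ∀ {σs} → Pred σs → All Term σs → Formula
  `¬_           : Formula → Formula
  _`∧_ _`∨_ _`⇒_ : Formula → Formula → Formula

record Model : Set where
  field
    assignment     : ∀ σ → ℕ → ⟦ σ ⟧ˢ
    boolAssignment : ℕ → Bool
    unspecified    : Unspecified

open Model public

evalTerm  : ∀ {σ} → Model → Term σ → ⟦ σ ⟧ˢ
evalTerms : ∀ {σs} → Model → All Term σs → All ⟦_⟧ˢ σs

evalTerm M (var σ x)  = assignment M σ x
evalTerm M (app o ts) = ⟦ o ⟧ᵒ (unspecified M) (evalTerms M ts)

evalTerms M []       = []
evalTerms M (t ∷ ts) = evalTerm M t ∷ evalTerms M ts

infix 3 _⊨_

_⊨_ : Model → Formula → Set
M ⊨ `⊤         = ⊤
M ⊨ `⊥         = ⊥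
M ⊨ boolVar x  = T (boolAssignment M x)
M ⊨ atom P ts  = ⟦ P ⟧ᵖ (evalTerms M ts)
M ⊨ `¬ φ       = ¬ (M ⊨ φ)
M ⊨ (φ `∧ ψ)   = (M ⊨ φ) × (M ⊨ ψ)
M ⊨ (φ `∨ ψ)   = (M ⊨ φ) ⊎ (M ⊨ ψ)
M ⊨ (φ `⇒ ψ)   = (M ⊨ φ) → (M ⊨ ψ)

Variable : Set
Variable = Sort × ℕ

data OccursInTerm (v : Variable) : ∀ {σ} → Term σ → Set
data OccursInTerms (v : Variable) : ∀ {σs} → All Term σs → Set

data OccursInTerm v where
  here : ∀ {σ x} → v ≡ (σ , x) → OccursInTerm v (var σ x)
  arg  : ∀ {σs σ} {o : Op σs σ} {ts} → OccursInTerms v ts → OccursInTerm v (app o ts)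

data OccursInTerms v where
  first : ∀ {σ σs} {t : Term σ} {ts : All Term σs} → OccursInTerm v t → OccursInTerms v (t ∷ ts)
  later : ∀ {σ σs} {t : Term σ} {ts : All Term σs} → OccursInTerms v ts → OccursInTerms v (t ∷ ts)

_OccursIn_ : Variable → Formula → Set
v OccursIn `⊤        = ⊥
v OccursIn `⊥        = ⊥
v OccursIn boolVar _ = ⊥
v OccursIn atom P ts = OccursInTerms v ts
v OccursIn (`¬ φ)    = v OccursIn φ
v OccursIn (φ `∧ ψ)  = v OccursIn φ ⊎ v OccursIn ψ
v OccursIn (φ `∨ ψ)  = v OccursIn φ ⊎ v OccursIn ψ
v OccursIn (φ `⇒ ψ)  = v OccursIn φ ⊎ v OccursIn ψ

Satisfiable : Formula → Set
Satisfiable φ = ∃[ M ] (M ⊨ φ)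

data Goal : Set where
  minimize maximize : Goal

Better : Goal → ∀ {f} → Float f → Float f → Set
Better minimize {f} x y = _<ᶠ_ {f} x y
Better maximize {f} x y = _<ᶠ_ {f} y x

AtLeastAsGood : Goal → ∀ {f} → Float f → Float f → Set
AtLeastAsGood minimize {f} x y = _≤ᶠ_ {f} x y
AtLeastAsGood maximize {f} x y = _≤ᶠ_ {f} y x

Constraint : Format → Set₁
Constraint f = Float f → Set

-- The restriction of μ to its k most significant bits, as a constraint.
_∣[_] : ∀ {f} → Float f → ℕ → Constraint f
_∣[_] {f} μ k v = ∀ (i : Fin (Format.n f)) → toℕ i < k → lookup v i ≡ lookup μ i

-- A^τ[i], where d is the dynamic attractor of τ.
matches : ∀ {f} → Float f → Fin (Format.n f) → Constraint f
matches d i v = lookup v i ≡ lookup d i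

record IsAttractor (g : Goal) {f : Format} (τ : Constraint f) (d : Float f) : Set where
  field
    nonNaN  : NonNaN f d
    agrees  : τ d
    extreme : ∀ v → NonNaN f v → τ v → AtLeastAsGood g {f} d v

record FlippedIf (P : Set) (b d : Bool) : Set where
  field
    flipped : P → b ≡ not d
    kept    : ¬ P → b ≡ d

module _ (f : Format) (φ : Formula) (x : ℕ) where

  cost : Model → Float f
  cost M = assignment M (float f) x

  noNaN : Formula
  noNaN = φ `∧ `¬ atom (nan {f}) (var (float f) x ∷ [])

  UnsatWith : Constraint f → Constraint f → Set
  UnsatWith C D = ¬ (∃[ M ] ((M ⊨ noNaN) × C (cost M) × D (cost M)))

  -- The simultaneous recursion for τ_k and d_{τ_k}, given by its defining
  -- equations because unsatisfiability is not decided constructively: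
  -- τ_k is the restriction of bits to the k most significant positions.
  record AttractorTrajectory (g : Goal) : Set where
    field
      bits      : Float f
      attractor : Fin (Format.n f) → Float f

    T[_] : Fin (Format.n f) → Constraint f
    T[ k ] = matches {f} (attractor k) k

    field
      isAttractor : ∀ k → IsAttractor g (_∣[_] {f} bits (toℕ k)) (attractor k)
      step        : ∀ k → FlippedIf (UnsatWith (_∣[_] {f} bits (toℕ k)) T[ k ])
                                    (lookup bits k) (lookup (attractor k) k)

  LexMaximizes : ∀ {g} → AttractorTrajectory g → Float f → Set
  LexMaximizes tr μ =
    ∀ k → FlippedIf (UnsatWith (_∣[_] {f} μ (toℕ k)) T[ k ])
                    (lookup μ k) (lookup (attractor k) k)
    where open AttractorTrajectory tr

  IsOptimal : Goal → Model → Set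
  IsOptimal g M = ¬ (∃[ M′ ] ((M′ ⊨ noNaN) × Better g {f} (cost M′) (cost M)))

{-# OPTIONS --safe #-}

-- A model that lexicographically maximizes the trajectory takes the same
-- decisions as the recursion for τ, so its cost μ agrees with τ and hence,
-- below any bit k, with the attractor d of τ_k. Let k be the first bit where
-- the cost y of a better model differs from μ. If μ[k] ≠ d[k], then y[k] = d[k]
-- and y refutes the unsatisfiability that made μ deviate from d. If
-- μ[k] = d[k], then for k > 0 both μ and d lie on the same side of y, because
-- floats of equal sign are ordered lexicographically; as d is extreme among
-- the floats that agree with τ_k, this is the side of the better values. For
-- the sign bit, d is extreme among all floats, and a y of the other sign that is
-- better than μ would make - μ better than d.
module Submission where

open import Defs
open import Data.Bool.Base using (Bool; true; false; not; if_then_else_; T)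
open import Data.Bool.Properties using (¬-not) renaming (_≟_ to _≟ᵇ_)
open import Data.Fin.Base using (Fin; toℕ; zero; suc)
open import Data.Fin.Induction using (<-wellFounded)
open import Data.Integer.Base as ℤ using (+_; -[1+_]; 0ℤ; 1ℤ)
import Data.Integer.Properties as ℤ
open import Data.Nat.Base
  using (ℕ; zero; suc; _+_; _*_; _^_; _<_; _≤_; _≡ᵇ_; z≤n; z<s; s<s; NonZero; _≤′_; ≤′-refl; ≤′-step)
import Data.Nat.Properties as ℕ
open import Data.Product.Base using (_×_; _,_; proj₂; map₁)
open import Data.Rational.Base as ℚ using (ℚ; 0ℚ; 1ℚ; fromℚᵘ)
import Data.Rational.Properties as ℚ
open import Algebra.Properties.Group ℚ.+-0-group using () renaming (⁻¹-involutive to -‿involutive)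
open import Data.Rational.Unnormalised.Base as ℚᵘ using (mkℚᵘ; 0ℚᵘ; 1ℚᵘ)
import Data.Rational.Unnormalised.Properties as ℚᵘ
open import Data.Sum.Base as Sum using (_⊎_; inj₁; inj₂)
open import Data.Unit.Base using (tt)
open import Data.Vec.Base using (Vec; []; _∷_; take; drop; lookup)
open import Data.Vec.Relation.Binary.Pointwise.Extensional using (ext; Pointwise-≡⇒≡)
open import Function.Base using (_∘_)
open import Induction.WellFounded using (Acc; acc)
open import Relation.Binary.PropositionalEquality
  using (_≡_; _≢_; refl; sym; trans; cong; subst; subst₂; ≢-sym)
open import Relation.Nullary.Decidable using (decidable-stable)
open import Relation.Nullary.Negation using (¬_; contradiction)

-- Bit vectors

infix 4 _≺_

-- The strict lexicographic order, most significant bit first.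
data _≺_ : ∀ {w} → Vec Bool w → Vec Bool w → Set where
  this : ∀ {w} {xs ys : Vec Bool w} → false ∷ xs ≺ true ∷ ys
  next : ∀ {w b} {xs ys : Vec Bool w} → xs ≺ ys → b ∷ xs ≺ b ∷ ys

AgreeBelow : ∀ {w} → ℕ → Vec Bool w → Vec Bool w → Set
AgreeBelow k xs ys = ∀ i → toℕ i < k → lookup xs i ≡ lookup ys i

agreeBelow⇒≺ : ∀ {w} (xs ys : Vec Bool w) (k : Fin w) → AgreeBelow (toℕ k) xs ys →
  lookup xs k ≡ false → lookup ys k ≡ true → xs ≺ ys
agreeBelow⇒≺ (_ ∷ _)  (_ ∷ _)  zero    agree refl refl = this
agreeBelow⇒≺ (_ ∷ xs) (_ ∷ ys) (suc k) agree x≡f y≡t with agree zero z<s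
... | refl = next (agreeBelow⇒≺ xs ys k (λ i i<k → agree (suc i) (s<s i<k)) x≡f y≡t)

-- `ys` carries the opposite bit at `k`, so `k` is the first difference from `ys` for `xs` and `ds`
-- alike, and their common bit there decides both comparisons in the same way.
sameSide : ∀ {w} (xs ds ys : Vec Bool w) (k : Fin w) →
  AgreeBelow (toℕ k) xs ys → AgreeBelow (toℕ k) ds ys →
  lookup xs k ≡ lookup ds k → lookup ys k ≢ lookup xs k →
  (xs ≺ ys × ds ≺ ys) ⊎ (ys ≺ xs × ys ≺ ds)
sameSide xs ds ys k x~y d~y x≡d y≢x with lookup xs k in x≡
... | false = inj₁ ( agreeBelow⇒≺ xs ys k x~y x≡ (¬-not y≢x)
                   , agreeBelow⇒≺ ds ys k d~y (sym x≡d) (¬-not y≢x) )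
... | true  = inj₂ ( agreeBelow⇒≺ ys xs k (λ i i<k → sym (x~y i i<k)) (¬-not y≢x) x≡
                   , agreeBelow⇒≺ ys ds k (λ i i<k → sym (d~y i i<k)) (¬-not y≢x) (sym x≡d) )

-- Well-founded induction on the position, suited to greedy rules that choose each bit by looking at
-- the more significant ones.
agree-inductively : ∀ {w} (xs ys : Vec Bool w) →
  (∀ k → AgreeBelow (toℕ k) xs ys → lookup xs k ≡ lookup ys k) → xs ≡ ys
agree-inductively xs ys step = Pointwise-≡⇒≡ (ext λ k → go k (<-wellFounded k))
  where
  go : ∀ k → Acc _ k → lookup xs k ≡ lookup ys k
  go k (acc rec) = step k λ i i<k → go i (rec i<k)

bin< : ∀ {w} (xs : Vec Bool w) → bin xs < 2 ^ w
bin< []                   = z<s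
bin< {suc w} (true ∷ xs)  rewrite ℕ.+-identityʳ (2 ^ w) = ℕ.+-monoʳ-< (2 ^ w) (bin< xs)
bin< {suc w} (false ∷ xs) = ℕ.≤-trans (bin< xs) (ℕ.m≤m+n (2 ^ w) _)

bin-mono : ∀ {w} {xs ys : Vec Bool w} → xs ≺ ys → bin xs < bin ys
bin-mono {suc w} (this {xs = xs}) = ℕ.≤-trans (bin< xs) (ℕ.m≤m+n (2 ^ w) _)
bin-mono         (next xs≺ys)     = ℕ.+-monoʳ-< _ (bin-mono xs≺ys)

-- Serves to separate the exponent field, which dominates the magnitude, from the significand.
≺-split : ∀ k {w} {xs ys : Vec Bool (k + w)} → xs ≺ ys →
  take k xs ≺ take k ys ⊎ (take k xs ≡ take k ys × drop k xs ≺ drop k ys)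
≺-split zero    xs≺ys        = inj₂ (refl , xs≺ys)
≺-split (suc k) this         = inj₁ this
≺-split (suc k) (next xs≺ys) = Sum.map next (map₁ (cong (_ ∷_))) (≺-split k xs≺ys)

-- Powers of two

-- `fromℚᵘ (mkℚᵘ (+ i) d)` computes to `+ i ℚ./ suc d`, so this lemma and the next two reduce facts
-- about normalized fractions to cross multiplication.
fromℚᵘ-mono-< : ∀ {p q} → p ℚᵘ.< q → fromℚᵘ p ℚ.< fromℚᵘ q
fromℚᵘ-mono-< {p} {q} p<q = ℚ.toℚᵘ-cancel-<
  (ℚᵘ.<-respˡ-≃ (ℚᵘ.≃-sym (ℚ.toℚᵘ-fromℚᵘ p)) (ℚᵘ.<-respʳ-≃ (ℚᵘ.≃-sym (ℚ.toℚᵘ-fromℚᵘ q)) p<q))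

fromℚᵘ-mono-≤ : ∀ {p q} → p ℚᵘ.≤ q → fromℚᵘ p ℚ.≤ fromℚᵘ q
fromℚᵘ-mono-≤ {p} {q} p≤q = ℚ.toℚᵘ-cancel-≤
  (ℚᵘ.≤-respˡ-≃ (ℚᵘ.≃-sym (ℚ.toℚᵘ-fromℚᵘ p)) (ℚᵘ.≤-respʳ-≃ (ℚᵘ.≃-sym (ℚ.toℚᵘ-fromℚᵘ q)) p≤q))

fromℚᵘ-homo-* : ∀ p q → fromℚᵘ p ℚ.* fromℚᵘ q ≡ fromℚᵘ (p ℚᵘ.* q)
fromℚᵘ-homo-* p q = ℚ.toℚᵘ-injective (ℚᵘ.≃-trans (ℚ.toℚᵘ-homo-* (fromℚᵘ p) (fromℚᵘ q))
  (ℚᵘ.≃-trans (ℚᵘ.*-cong (ℚ.toℚᵘ-fromℚᵘ p) (ℚ.toℚᵘ-fromℚᵘ q)) (ℚᵘ.≃-sym (ℚ.toℚᵘ-fromℚᵘ (p ℚᵘ.* q)))))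

/-monoˡ-< : ∀ {i j} d .{{_ : NonZero d}} → i < j → + i ℚ./ d ℚ.< + j ℚ./ d
/-monoˡ-< {i} {j} (suc d) i<j = fromℚᵘ-mono-< {mkℚᵘ (+ i) d} {mkℚᵘ (+ j) d}
  (ℚᵘ.*<* (ℤ.*-monoʳ-<-pos (+ suc d) (ℤ.+<+ i<j)))

0≤/ : ∀ i d .{{_ : NonZero d}} → 0ℚ ℚ.≤ + i ℚ./ d
0≤/ i (suc d) = fromℚᵘ-mono-≤ {0ℚᵘ} {mkℚᵘ (+ i) d}
  (ℚᵘ.*≤* (subst (0ℤ ℤ.≤_) (sym (ℤ.*-identityʳ (+ i))) (ℤ.+≤+ z≤n)))

/<1 : ∀ {i} d .{{_ : NonZero d}} → i < d → + i ℚ./ d ℚ.< 1ℚ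
/<1 {i} (suc d) i<d = fromℚᵘ-mono-< {mkℚᵘ (+ i) d} {1ℚᵘ}
  (ℚᵘ.*<* (subst₂ ℤ._<_ (sym (ℤ.*-identityʳ (+ i))) (sym (ℤ.*-identityˡ (+ suc d))) (ℤ.+<+ i<d)))

2ℚ : ℚ
2ℚ = + 2 ℚ./ 1

2*1/2* : ∀ d .{{_ : NonZero d}} .{{_ : NonZero (2 * d)}} → 2ℚ ℚ.* (1ℤ ℚ./ (2 * d)) ≡ 1ℤ ℚ./ d
-- `mkℚᵘ` stores the denominator minus one, and `2 * suc d` computes to `suc (d + suc (d + 0))`.
2*1/2* (suc d) = trans (fromℚᵘ-homo-* (mkℚᵘ (+ 2) 0) (mkℚᵘ 1ℤ (d + suc (d + 0))))
  (ℚ.fromℚᵘ-cong {mkℚᵘ (+ 2) 0 ℚᵘ.* mkℚᵘ 1ℤ (d + suc (d + 0))} {mkℚᵘ 1ℤ d}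
    (ℚᵘ.*≡* (cong +_ (sym (trans (ℕ.+-identityʳ _) (ℕ.+-identityʳ _))))))

pow2-suc : ∀ z → pow2 (ℤ.suc z) ≡ 2ℚ ℚ.* pow2 z
pow2-suc (+ k)        = sym (trans (fromℚᵘ-homo-* (mkℚᵘ (+ 2) 0) (mkℚᵘ (+ (2 ^ k)) 0))
  (cong (ℚ._/ 1) (sym (ℤ.pos-* 2 (2 ^ k)))))
pow2-suc -[1+ zero ]  = refl
pow2-suc -[1+ suc k ] = sym (2*1/2* (2 ^ suc k) {{ℕ.m^n≢0 2 (suc k)}} {{ℕ.m^n≢0 2 (suc (suc k))}})

pow2-positive : ∀ z → ℚ.Positive (pow2 z)
pow2-positive (+ k)    = ℚ.normalize-pos (2 ^ k) 1 {{_}} {{ℕ.m^n≢0 2 k}}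
pow2-positive -[1+ k ] = ℚ.normalize-pos 1 (2 ^ suc k) {{ℕ.m^n≢0 2 (suc k)}}

-- Magnitudes

module _ (f : Format) where

  private
    instance
      2^m≢0 : NonZero (2 ^ Format.m f)
      2^m≢0 = ℕ.m^n≢0 2 (Format.m f)

  -- For positive `E` this is the least magnitude with exponent field `E`; the subnormals are
  -- multiples of `scale 1`, not of `scale 0`.
  scale : ℕ → ℚ
  scale E = pow2 (+ E ℤ.- + bias f)

  scale-suc : ∀ E → scale (suc E) ≡ 2ℚ ℚ.* scale E
  scale-suc E = trans (cong pow2 (ℤ.suc-+ E (ℤ.- + bias f))) (pow2-suc (+ E ℤ.- + bias f))

  instance
    scale-positive : ∀ {E} → ℚ.Positive (scale E)
    scale-positive {E} = pow2-positive (+ E ℤ.- + bias f)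

  0<scale : ∀ E → 0ℚ ℚ.< scale E
  0<scale E = ℚ.positive⁻¹ (scale E)

  scale-mono : ∀ {E E′} → E ≤′ E′ → scale E ℚ.≤ scale E′
  scale-mono ≤′-refl = ℚ.≤-refl
  scale-mono {E} {suc E′} (≤′-step E≤E′) = begin
    scale E           ≤⟨ scale-mono E≤E′ ⟩
    scale E′          ≡⟨ ℚ.*-identityˡ (scale E′) ⟨
    1ℚ ℚ.* scale E′   ≤⟨ ℚ.*-monoʳ-≤-nonNeg (scale E′) {{ℚ.pos⇒nonNeg (scale E′)}} (ℚ.<⇒≤ (/-monoˡ-< 1 (ℕ.n<1+n 1))) ⟩
    2ℚ ℚ.* scale E′   ≡⟨ scale-suc E′ ⟨
    scale (suc E′)    ∎
    where open ℚ.≤-Reasoning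

  magnitude<scale : ∀ E {M} → M < 2 ^ Format.m f → magnitude f E M ℚ.< scale (suc E)
  magnitude<scale zero M< = ℚ.<-respʳ-≡ (ℚ.*-identityʳ (scale 1))
    (ℚ.*-monoʳ-<-pos (scale 1) (/<1 _ M<))
  magnitude<scale (suc E) M< = ℚ.<-respʳ-≡
    (trans (ℚ.*-comm (scale (suc E)) 2ℚ) (sym (scale-suc (suc E))))
    (ℚ.*-monoʳ-<-pos (scale (suc E)) (ℚ.+-monoʳ-< 1ℚ (/<1 _ M<)))

  scale≤magnitude : ∀ E M → scale (suc E) ℚ.≤ magnitude f (suc E) M
  scale≤magnitude E M = subst (ℚ._≤ magnitude f (suc E) M) (ℚ.*-identityʳ (scale (suc E)))
    (ℚ.*-monoˡ-≤-nonNeg (scale (suc E)) {{ℚ.pos⇒nonNeg (scale (suc E))}}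
      (ℚ.+-monoʳ-≤ 1ℚ (0≤/ M (2 ^ Format.m f))))

  0≤magnitude : ∀ E M → 0ℚ ℚ.≤ magnitude f E M
  0≤magnitude zero    M = subst (ℚ._≤ magnitude f zero M) (ℚ.*-zeroʳ (scale 1))
    (ℚ.*-monoˡ-≤-nonNeg (scale 1) {{ℚ.pos⇒nonNeg (scale 1)}} (0≤/ M (2 ^ Format.m f)))
  0≤magnitude (suc E) M = ℚ.≤-trans (ℚ.<⇒≤ (0<scale (suc E))) (scale≤magnitude E M)

  magnitude-monoʳ : ∀ E {M M′} → M < M′ → magnitude f E M ℚ.< magnitude f E M′
  magnitude-monoʳ zero    M<M′ = ℚ.*-monoʳ-<-pos (scale 1) (/-monoˡ-< _ M<M′)
  magnitude-monoʳ (suc E) M<M′ = ℚ.*-monoʳ-<-pos (scale (suc E)) (ℚ.+-monoʳ-< 1ℚ (/-monoˡ-< _ M<M′))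

  -- The powers of two separate the exponents: field `E` stays below `scale (suc E)`, and `E′`,
  -- being positive, starts at `scale E′`, which is no smaller.
  magnitude-monoˡ : ∀ {E E′ M} M′ → M < 2 ^ Format.m f → E < E′ → magnitude f E M ℚ.< magnitude f E′ M′
  magnitude-monoˡ {E} {suc E′} M′ M< E<E′ = ℚ.<-≤-trans (magnitude<scale E M<)
    (ℚ.≤-trans (scale-mono (ℕ.≤⇒≤′ E<E′)) (scale≤magnitude E′ M′))

-- Values

negᵛ : Value → Value
negᵛ NaN     = NaN
negᵛ -∞      = +∞
negᵛ (fin q) = fin (ℚ.- q)
negᵛ +∞      = -∞

negᵛ-involutive : ∀ v → negᵛ (negᵛ v) ≡ v
negᵛ-involutive NaN     = refl
negᵛ-involutive -∞      = refl
negᵛ-involutive (fin q) = cong fin (-‿involutive q)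
negᵛ-involutive +∞      = refl

negᵛ-NaN : ∀ {v} → negᵛ v ≡ NaN → v ≡ NaN
negᵛ-NaN {NaN} refl = refl

negᵛ-antimono-< : ∀ {u v} → u <ᵛ v → negᵛ v <ᵛ negᵛ u
negᵛ-antimono-< -∞<fin        = fin<+∞
negᵛ-antimono-< -∞<+∞         = -∞<+∞
negᵛ-antimono-< (fin<fin p<q) = fin<fin (ℚ.neg-antimono-< p<q)
negᵛ-antimono-< fin<+∞        = -∞<fin

negᵛ-antimono-≤ : ∀ {u v} → u ≤ᵛ v → negᵛ v ≤ᵛ negᵛ u
negᵛ-antimono-≤ (-∞≤ v≢NaN)   = ≤+∞ (v≢NaN ∘ negᵛ-NaN)
negᵛ-antimono-≤ (fin≤fin p≤q) = fin≤fin (ℚ.neg-antimono-≤ p≤q)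
negᵛ-antimono-≤ (≤+∞ u≢NaN)   = -∞≤ (u≢NaN ∘ negᵛ-NaN)

<ᵛ⇒≱ᵛ : ∀ {u v} → u <ᵛ v → ¬ v ≤ᵛ u
<ᵛ⇒≱ᵛ (fin<fin p<q) (fin≤fin q≤p) = ℚ.<-irrefl refl (ℚ.<-≤-trans p<q q≤p)

<ᵛ-asym : ∀ {u v} → u <ᵛ v → ¬ v <ᵛ u
<ᵛ-asym (fin<fin p<q) (fin<fin q<p) = ℚ.<-asym p<q q<p

<ᵛ-irrefl : ∀ {v} → ¬ v <ᵛ v
<ᵛ-irrefl v<v = <ᵛ-asym v<v v<v

≤ᵛ-<ᵛ-trans : ∀ {u v w} → u ≤ᵛ v → v <ᵛ w → u <ᵛ w
≤ᵛ-<ᵛ-trans (-∞≤ _)       -∞<fin        = -∞<fin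
≤ᵛ-<ᵛ-trans (-∞≤ _)       -∞<+∞         = -∞<+∞
≤ᵛ-<ᵛ-trans (-∞≤ _)       (fin<fin _)   = -∞<fin
≤ᵛ-<ᵛ-trans (-∞≤ _)       fin<+∞        = -∞<+∞
≤ᵛ-<ᵛ-trans (fin≤fin p≤q) (fin<fin q<r) = fin<fin (ℚ.≤-<-trans p≤q q<r)
≤ᵛ-<ᵛ-trans (fin≤fin _)   fin<+∞        = fin<+∞

<ᵛ-≤ᵛ-trans : ∀ {u v w} → u <ᵛ v → v ≤ᵛ w → u <ᵛ w
<ᵛ-≤ᵛ-trans {u} {v} {w} u<v v≤w = subst₂ _<ᵛ_ (negᵛ-involutive u) (negᵛ-involutive w)
  (negᵛ-antimono-< (≤ᵛ-<ᵛ-trans (negᵛ-antimono-≤ v≤w) (negᵛ-antimono-< u<v)))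

-- `value f (false ∷ t)` reduces to this function of the two fields, so its properties apply to
-- floats without rewriting.
absValue : Format → ℕ → ℕ → Value
absValue f E M =
  if E ≡ᵇ maxE f then (if M ≡ᵇ 0 then +∞ else NaN) else fin (magnitude f E M)

≡ᵇ-true : ∀ {m n} → (m ≡ᵇ n) ≡ true → m ≡ n
≡ᵇ-true {m} {n} eqn = ℕ.≡ᵇ⇒≡ m n (subst T (sym eqn) tt)

-- With distinct exponents the smaller one is not all ones, so its value is finite. With equal
-- exponents all ones is impossible, since the larger significand is nonzero and would give NaN.
absValue-mono : ∀ f {E M E′ M′} → M < 2 ^ Format.m f → E′ ≤ maxE f →
  absValue f E M ≢ NaN → absValue f E′ M′ ≢ NaN →
  E < E′ ⊎ (E ≡ E′ × M < M′) → absValue f E M <ᵛ absValue f E′ M′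
absValue-mono f {E} {M} {E′} {M′} M< E′≤ a≢ b≢ (inj₁ E<E′) with E ≡ᵇ maxE f in eqn | E′ ≡ᵇ maxE f
... | true  | _     = contradiction (ℕ.≤-trans E<E′ E′≤) (ℕ.<-irrefl (≡ᵇ-true eqn))
... | false | false = fin<fin (magnitude-monoˡ f M′ M< E<E′)
... | false | true with M′ ≡ᵇ 0
...   | true  = fin<+∞
...   | false = contradiction refl b≢
absValue-mono f {E} {M} {_} {suc M′} M< E′≤ a≢ b≢ (inj₂ (refl , M<M′)) with E ≡ᵇ maxE f
... | true  = contradiction refl b≢
... | false = fin<fin (magnitude-monoʳ f E M<M′)

0≤absValue : ∀ f E M → absValue f E M ≢ NaN → fin 0ℚ ≤ᵛ absValue f E M
0≤absValue f E M a≢ with E ≡ᵇ maxE f | M ≡ᵇ 0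
... | true  | true  = ≤+∞ λ ()
... | true  | false = contradiction refl a≢
... | false | _     = fin≤fin (0≤magnitude f E M)

-- Floats

module _ (f : Format) where

  private
    Tail : Set
    Tail = Vec Bool (Format.e f + Format.m f)

  value-true : ∀ (t : Tail) → value f (true ∷ t) ≡ negᵛ (value f (false ∷ t))
  value-true t with exponent f (false ∷ t) ≡ᵇ maxE f | significand f (false ∷ t) ≡ᵇ 0
  ... | true  | true  = refl
  ... | true  | false = refl
  ... | false | _     = refl

  value-not : ∀ σ (t : Tail) → value f (not σ ∷ t) ≡ negᵛ (value f (σ ∷ t))
  value-not false t = value-true t
  value-not true  t = trans (sym (negᵛ-involutive _)) (cong negᵛ (sym (value-true t)))

  nonNaN-not : ∀ σ (t : Tail) → NonNaN f (σ ∷ t) → NonNaN f (not σ ∷ t)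
  nonNaN-not σ t x≢NaN eqn = x≢NaN (negᵛ-NaN (trans (sym (value-not σ t)) eqn))

  0≤positive : ∀ (t : Tail) → NonNaN f (false ∷ t) → fin 0ℚ ≤ᵛ value f (false ∷ t)
  0≤positive t = 0≤absValue f (exponent f (false ∷ t)) (significand f (false ∷ t))

  negative≤0 : ∀ (t : Tail) → NonNaN f (true ∷ t) → value f (true ∷ t) ≤ᵛ fin 0ℚ
  negative≤0 t x≢NaN = subst (_≤ᵛ fin 0ℚ) (sym (value-not false t))
    (negᵛ-antimono-≤ (0≤positive t (nonNaN-not true t x≢NaN)))

  ≺⇒<ᶠ : ∀ {t u : Tail} → NonNaN f (false ∷ t) → NonNaN f (false ∷ u) →
    t ≺ u → _<ᶠ_ {f} (false ∷ t) (false ∷ u)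
  ≺⇒<ᶠ {t} {u} x≢NaN y≢NaN t≺u = absValue-mono f
    -- `maxE f` is the predecessor of the strict bound on the exponent field.
    (bin< (drop (Format.e f) t)) (ℕ.<⇒≤pred (bin< (take (Format.e f) u))) x≢NaN y≢NaN
    (Sum.map bin-mono (λ (E≡ , M≺) → cong bin E≡ , bin-mono M≺) (≺-split (Format.e f) t≺u))

  ≺⇒>ᶠ : ∀ {t u : Tail} → NonNaN f (true ∷ t) → NonNaN f (true ∷ u) →
    t ≺ u → _<ᶠ_ {f} (true ∷ u) (true ∷ t)
  ≺⇒>ᶠ {t} {u} x≢NaN y≢NaN t≺u = subst₂ _<ᵛ_ (sym (value-not false u)) (sym (value-not false t))
    (negᵛ-antimono-< (≺⇒<ᶠ (nonNaN-not true t x≢NaN) (nonNaN-not true u y≢NaN) t≺u))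

  -- A set sign bit reverses the order of the tails, but it does so for both comparisons at once.
  sameSideᶠ : ∀ σ {t w u : Tail} → NonNaN f (σ ∷ t) → NonNaN f (σ ∷ w) → NonNaN f (σ ∷ u) →
    (t ≺ u × w ≺ u) ⊎ (u ≺ t × u ≺ w) →
    (_<ᶠ_ {f} (σ ∷ t) (σ ∷ u) × _<ᶠ_ {f} (σ ∷ w) (σ ∷ u)) ⊎
    (_<ᶠ_ {f} (σ ∷ u) (σ ∷ t) × _<ᶠ_ {f} (σ ∷ u) (σ ∷ w))
  sameSideᶠ false x≢ d≢ y≢ (inj₁ (t≺u , w≺u)) = inj₁ (≺⇒<ᶠ x≢ y≢ t≺u , ≺⇒<ᶠ d≢ y≢ w≺u)
  sameSideᶠ false x≢ d≢ y≢ (inj₂ (u≺t , u≺w)) = inj₂ (≺⇒<ᶠ y≢ x≢ u≺t , ≺⇒<ᶠ y≢ d≢ u≺w)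
  sameSideᶠ true  x≢ d≢ y≢ (inj₁ (t≺u , w≺u)) = inj₂ (≺⇒>ᶠ x≢ y≢ t≺u , ≺⇒>ᶠ d≢ y≢ w≺u)
  sameSideᶠ true  x≢ d≢ y≢ (inj₂ (u≺t , u≺w)) = inj₁ (≺⇒>ᶠ y≢ x≢ u≺t , ≺⇒>ᶠ y≢ d≢ u≺w)

  -- On the better side of `y`, `x` itself rules out that `y` improves on it; on the worse side, `d`
  -- would be worse than `y`, against its extremality.
  sameSide-notBetter : ∀ g {x d y : Float f} →
    (_<ᶠ_ {f} x y × _<ᶠ_ {f} d y) ⊎ (_<ᶠ_ {f} y x × _<ᶠ_ {f} y d) →
    AtLeastAsGood g {f} d y → ¬ Better g {f} y x
  sameSide-notBetter minimize (inj₁ (x<y , _)) d≤y y<x = <ᵛ-asym x<y y<x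
  sameSide-notBetter minimize (inj₂ (_ , y<d)) d≤y y<x = <ᵛ⇒≱ᵛ y<d d≤y
  sameSide-notBetter maximize (inj₁ (_ , d<y)) y≤d x<y = <ᵛ⇒≱ᵛ d<y y≤d
  sameSide-notBetter maximize (inj₂ (y<x , _)) y≤d x<y = <ᵛ-asym y<x x<y

  oppositeSign-notBetter : ∀ g σ (t w u : Tail) →
    NonNaN f (σ ∷ t) → NonNaN f (σ ∷ w) → NonNaN f (not σ ∷ u) →
    (∀ v → NonNaN f v → AtLeastAsGood g {f} (σ ∷ w) v) →
    ¬ Better g {f} (not σ ∷ u) (σ ∷ t)
  oppositeSign-notBetter minimize true t w u x≢ d≢ y≢ extreme y<x =
    <ᵛ⇒≱ᵛ (<ᵛ-≤ᵛ-trans y<x (negative≤0 t x≢)) (0≤positive u y≢)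
  oppositeSign-notBetter minimize false t w u x≢ d≢ y≢ extreme y<x =
    <ᵛ⇒≱ᵛ (≤ᵛ-<ᵛ-trans d≤-x -x<0) (0≤positive w d≢)
    where
    d≤-x = subst (value f (false ∷ w) ≤ᵛ_) (value-not false t)
             (extreme (true ∷ t) (nonNaN-not false t x≢))
    -- The negation of 0 ≤ d ≤ y < x, where `ℚ.- 0ℚ` computes to `0ℚ`.
    -x<0 = negᵛ-antimono-<
             (≤ᵛ-<ᵛ-trans (0≤positive w d≢) (≤ᵛ-<ᵛ-trans (extreme (true ∷ u) y≢) y<x))
  oppositeSign-notBetter maximize true t w u x≢ d≢ y≢ extreme x<y =
    <ᵛ⇒≱ᵛ (<ᵛ-≤ᵛ-trans 0<-x -x≤d) (negative≤0 w d≢)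
    where
    -x≤d = subst (_≤ᵛ value f (true ∷ w)) (value-not true t)
             (extreme (false ∷ t) (nonNaN-not true t x≢))
    0<-x = negᵛ-antimono-<
             (<ᵛ-≤ᵛ-trans (<ᵛ-≤ᵛ-trans x<y (extreme (false ∷ u) y≢)) (negative≤0 w d≢))
  oppositeSign-notBetter maximize false t w u x≢ d≢ y≢ extreme x<y =
    <ᵛ⇒≱ᵛ (<ᵛ-≤ᵛ-trans x<y (negative≤0 u y≢)) (0≤positive t x≢)

  firstDifference-notBetter : ∀ g (τ x d y : Float f) (k : Fin (Format.n f)) →
    IsAttractor g (_∣[_] {f} τ (toℕ k)) d → NonNaN f x → NonNaN f y →
    AgreeBelow (toℕ k) x τ → AgreeBelow (toℕ k) y τ →
    lookup x k ≡ lookup d k → lookup y k ≢ lookup x k → ¬ Better g {f} y x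
  firstDifference-notBetter g τ (σ ∷ t) (_ ∷ w) (_ ∷ u) zero att x≢ y≢ x~τ y~τ refl y≢x
    with ¬-not y≢x
  ... | refl = oppositeSign-notBetter g σ t w u x≢ (IsAttractor.nonNaN att) y≢
                 -- No position precedes the sign bit, so agreement with `τ` is vacuous.
                 (λ v v≢ → IsAttractor.extreme att v v≢ λ _ ())
  firstDifference-notBetter g τ (σ ∷ t) (_ ∷ w) (_ ∷ u) (suc k) att x≢ y≢ x~τ y~τ x≡d y≢x
    -- The sign bit lies below position `suc k`, so `x`, `d` and `y` share it and their tails can be
    -- compared.
    with trans (x~τ zero z<s) (sym (y~τ zero z<s))
       | trans (IsAttractor.agrees att zero z<s) (sym (y~τ zero z<s))
  ... | refl | refl = sameSide-notBetter g {σ ∷ t} {σ ∷ w} {σ ∷ u}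
    (sameSideᶠ σ x≢ nonNaN y≢ (sameSide t w u k (agree x~τ) (agree agrees) x≡d y≢x))
    (extreme (σ ∷ u) y≢ y~τ)
    where
    open IsAttractor att
    agree : ∀ {b} {v : Tail} → AgreeBelow (suc (toℕ k)) (b ∷ v) τ → AgreeBelow (toℕ k) v u
    agree v~τ i i<k = trans (v~τ (suc i) (s<s i<k)) (sym (y~τ (suc i) (s<s i<k)))

-- Greedy bits and optimality

-- `P` need not be decidable, but equality of bits is. Were the bits different, `P` would fail, as
-- it would flip both; then both would be kept, hence equal.
FlippedIf-unique : ∀ {P Q b c d} → (P → Q) → (Q → P) → FlippedIf P b d → FlippedIf Q c d → b ≡ c
FlippedIf-unique {b = b} {c} P⇒Q Q⇒P fb fc = decidable-stable (b ≟ᵇ c) λ b≢c →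
  let ¬p = λ p → b≢c (trans (FlippedIf.flipped fb p) (sym (FlippedIf.flipped fc (P⇒Q p))))
  in b≢c (trans (FlippedIf.kept fb ¬p) (sym (FlippedIf.kept fc (¬p ∘ Q⇒P))))

theorem2 : (f : Format) (φ : Formula) (x : ℕ) →
    (float f , x) OccursIn φ →
    Satisfiable (noNaN f φ x) →
    (g : Goal) (tr : AttractorTrajectory f φ x g) →
    (M : Model) → M ⊨ noNaN f φ x →
    LexMaximizes f φ x tr (cost f φ x M) →
    IsOptimal f φ x g M
theorem2 f φ x _ _ g tr M (_ , μ≢NaN) lex (M′ , M′⊨ , better) =
  -- No bit of `y` can be the first to differ from `μ`, so `better` would compare `μ` with itself.
  irreflexive g (subst (λ y → Better g {f} y μ) y≡μ better)
  where
  open AttractorTrajectory tr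

  μ y : Float f
  μ = cost f φ x M
  y = cost f φ x M′

  μ≡bits : μ ≡ bits
  -- Below `k` both vectors impose the same constraint, so the two unsatisfiability conditions are
  -- equivalent.
  μ≡bits = agree-inductively μ bits λ k μ~bits → FlippedIf-unique
    (λ unsat (N , N⊨ , N~bits , hit) → unsat (N , N⊨ , (λ i i<k → trans (N~bits i i<k) (sym (μ~bits i i<k))) , hit))
    (λ unsat (N , N⊨ , N~μ , hit) → unsat (N , N⊨ , (λ i i<k → trans (N~μ i i<k) (μ~bits i i<k)) , hit))
    (lex k) (step k)

  y≡μ : y ≡ μ
  y≡μ = agree-inductively y μ λ k y~μ → decidable-stable (lookup y k ≟ᵇ lookup μ k) λ y≢μ →
    let μ≡d : lookup μ k ≡ lookup (attractor k) k
        μ≡d = decidable-stable (_ ≟ᵇ _) λ μ≢d → μ≢d (FlippedIf.kept (lex k) λ unsat →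
          -- The bits of `y` and of the attractor both differ from that of `μ`, so they coincide.
          unsat (M′ , M′⊨ , y~μ , trans (¬-not y≢μ) (sym (¬-not (≢-sym μ≢d)))))
        ~bits = λ i → cong (λ v → lookup v i) μ≡bits
    in firstDifference-notBetter f g bits μ (attractor k) y k (isAttractor k) μ≢NaN (proj₂ M′⊨)
         (λ i _ → ~bits i) (λ i i<k → trans (y~μ i i<k) (~bits i)) μ≡d y≢μ better

  irreflexive : ∀ g → ¬ Better g {f} μ μ
  irreflexive minimize = <ᵛ-irrefl
  irreflexive maximize = <ᵛ-irrefl
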